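{- Let $G$ be a unicyclic graph whose only cycle $C^*$ has length $k$ and whose set of pendant vertices is $L(G)$, with $|L(G)|=l$. Let $V^+_{c^*}$ be the set of vertices of $C^*$ with degree at least $3$ in $G$. If $G'$ is obtained from $G$ by removing an edge $e=uv$ of $C^*$, then $$meg(G')=\begin{cases} l, & \text{if } u,v\in V^+_{c^*},\\ l+1, & \text{if exactly one of } u,v \text{ belongs to } V^+_{c^*},\\ l+2, & \text{if } u,v\notin V^+_{c^*}.\end{cases}$$
   Context: Graphs are finite, undirected and simple; a unicyclic graph is a connected graph containing exactly one cycle; a pendant vertex is a vertex of degree $1$. In a connected graph $H$, an edge $e$ is monitored by a pair of vertices $x,y$ if $e$ lies on all shortest paths between $x$ and $y$. A set $M\subseteq V(H)$ is a monitoring edge-geodetic set (MEG-set) of $H$ if every edge of $H$ is monitored by some pair of vertices of $M$; $meg(H)$ is the minimum size of a MEG-set of $H$. -}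

module Defs where

open import Data.Fin.Base using (Fin)
import Data.Fin.Properties as Fin
open import Data.Fin.Subset using (Subset; _∈_; ∣_∣)
open import Data.List.Base using (List; []; _∷_; length)
import Data.List.Membership.Propositional as List
open import Data.List.Relation.Unary.Any using (Any)
open import Data.List.Relation.Unary.Unique.Propositional using (Unique)
open import Data.Nat.Base using (ℕ; _≤_)
import Data.Nat.Properties as ℕ
open import Data.Product.Base using (_×_; _,_; ∃₂; ∃-syntax)
open import Data.Sum.Base using (_⊎_; inj₁; inj₂)
open import Data.Vec.Base using (tabulate)
open import Function.Bundles using (_⇔_)
open import Level using (0ℓ)
open import Relation.Binary.Construct.Closure.ReflexiveTransitive using (Star; ε; _◅_)
open import Relation.Binary.Core using (Rel)
open import Relation.Binary.Definitions using (Decidable; Irreflexive; Symmetric)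
open import Relation.Binary.PropositionalEquality.Core using (_≡_)
open import Relation.Nullary.Decidable using (⌊_⌋; ¬?; _×-dec_; _⊎-dec_)
open import Relation.Nullary.Negation using (¬_)
open import Relation.Unary using (Pred)

record Graph (n : ℕ) : Set₁ where
  infix 4 _~_ _~?_
  field
    _~_    : Rel (Fin n) 0ℓ
    _~?_   : Decidable _~_
    sym    : Symmetric _~_
    irrefl : Irreflexive _≡_ _~_

-- Edges are written as ordered pairs of endpoints; _≈ᵉ_ forgets the order.
infix 4 _≈ᵉ_ _≈ᵉ?_

_≈ᵉ_ : ∀ {n} → Rel (Fin n × Fin n) 0ℓ
(a , b) ≈ᵉ (c , d) = (a ≡ c × b ≡ d) ⊎ (a ≡ d × b ≡ c)

_≈ᵉ?_ : ∀ {n} → Decidable (_≈ᵉ_ {n})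
(a , b) ≈ᵉ? (c , d) =
  ((a Fin.≟ c) ×-dec (b Fin.≟ d)) ⊎-dec ((a Fin.≟ d) ×-dec (b Fin.≟ c))

infix 4 _∈ᵉ_

_∈ᵉ_ : ∀ {n} → Fin n × Fin n → List (Fin n × Fin n) → Set
e ∈ᵉ es = Any (e ≈ᵉ_) es

removeEdge : ∀ {n} → Graph n → Fin n × Fin n → Graph n
removeEdge G e = record
  { _~_    = λ x y → x ~ y × ¬ ((x , y) ≈ᵉ e)
  ; _~?_   = λ x y → (x ~? y) ×-dec ¬? ((x , y) ≈ᵉ? e)
  ; sym    = λ (p , x≉e) → sym p , λ y≈e → x≉e (swap y≈e)
  ; irrefl = λ x≡y (p , _) → irrefl x≡y p
  }
  where
  open Graph G
  swap : ∀ {x y} → (y , x) ≈ᵉ e → (x , y) ≈ᵉ e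
  swap (inj₁ (p , q)) = inj₂ (q , p)
  swap (inj₂ (p , q)) = inj₁ (q , p)

module _ {n : ℕ} (G : Graph n) where
  open Graph G

  neighbours : Fin n → Subset n
  neighbours x = tabulate λ y → ⌊ x ~? y ⌋

  degree : Fin n → ℕ
  degree x = ∣ neighbours x ∣

  pendants : Subset n
  pendants = tabulate λ x → ⌊ degree x ℕ.≟ 1 ⌋

  Walk : Rel (Fin n) 0ℓ
  Walk = Star _~_

  walkVertices : ∀ {x y} → Walk x y → List (Fin n)
  walkVertices {x} ε       = x ∷ []
  walkVertices {x} (_ ◅ w) = x ∷ walkVertices w

  walkEdges : ∀ {x y} → Walk x y → List (Fin n × Fin n)
  walkEdges ε                     = []
  walkEdges {x} (_◅_ {j = z} _ w) = (x , z) ∷ walkEdges w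

  record Path (x y : Fin n) : Set where
    field
      walk   : Walk x y
      simple : Unique (walkVertices walk)

    vertices : List (Fin n)
    vertices = walkVertices walk

    edges : List (Fin n × Fin n)
    edges = walkEdges walk

    size : ℕ
    size = length edges

  Connected : Set
  Connected = ∀ x y → Path x y

  -- A cycle is presented by a path together with an edge joining its last
  -- vertex to its first one, so each cycle has one presentation for every
  -- choice of starting point and direction; see SameCycle.
  record Cycle : Set where
    field
      {first last} : Fin n
      path         : Path first last
      closing      : last ~ first
      long         : 2 ≤ Path.size path

    vertices : List (Fin n)
    vertices = Path.vertices path

    edges : List (Fin n × Fin n)
    edges = (last , first) ∷ Path.edges path

    size : ℕ
    size = length edges

  -- Cycles are subgraphs, hence determined by their edge sets.
  SameCycle : Rel Cycle 0ℓ
  SameCycle C D = ∀ e → e ∈ᵉ Cycle.edges C ⇔ e ∈ᵉ Cycle.edges D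

  record Unicyclic : Set where
    field
      connected : Connected
      cycle     : Cycle
      unique    : ∀ C → SameCycle C cycle

  V⁺ : Cycle → Pred (Fin n) 0ℓ
  V⁺ C x = x List.∈ Cycle.vertices C × 3 ≤ degree x

  Shortest : ∀ {x y} → Path x y → Set
  Shortest {x} {y} p = ∀ (q : Path x y) → Path.size p ≤ Path.size q

  Monitors : Fin n → Fin n → Fin n × Fin n → Set
  Monitors x y e = ∀ (p : Path x y) → Shortest p → e ∈ᵉ Path.edges p

  MEGSet : Subset n → Set
  MEGSet M = ∀ {a b} → a ~ b →
    ∃₂ λ x y → x ∈ M × y ∈ M × Monitors x y (a , b)

  -- IsMeg m says that meg is defined, i.e. the graph is connected, and that
  -- its value is m.
  record IsMeg (m : ℕ) : Set where
    field
      connected : Connected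
      attained  : ∃[ M ] MEGSet M × ∣ M ∣ ≡ m
      minimal   : ∀ M → MEGSet M → m ≤ ∣ M ∣

{-# OPTIONS --safe #-}

-- Removing the edge uv of its only cycle turns G into a tree G′.  In a graph
-- without cycles each edge ab is a bridge, and walking away from ab on either
-- side one reaches a pendant vertex, so the pendant vertices form an MEG-set.
-- Conversely a pendant vertex is never an inner vertex of a path, so the edge
-- at it can only be monitored by a pair containing it.  Hence meg(G′) is the
-- number of pendant vertices of G′.  These are the pendant vertices of G
-- together with those of u, v that have degree 2 in G.
module Submission where

open import Defs
open import Data.Fin.Base using (Fin)
open import Data.Fin.Properties using (_≟_; any?)
open import Data.Fin.Subset using (Subset; ∣_∣; ⁅_⁆; ⊤; _-_)
  renaming (_∈_ to _∈ˢ_; _∉_ to _∉ˢ_; _⊆_ to _⊆ˢ_)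
open import Data.Fin.Subset.Properties
  using (nonempty?; Empty-unique; ∣⊥∣≡0; x∈⁅x⁆; x∈⁅y⁆⇒x≡y; ∣⁅x⁆∣≡1; ⊆-antisym;
         p⊆q⇒∣p∣≤∣q∣; p─⊥≡p; p─q⊆p; p─q─q≡p─q; x∈p∧x≢y⇒x∈p-y; x∈p⇒∣p-x∣<∣p∣;
         ∈⊤; ∣p∣≤n)
  renaming (_∈?_ to _∈ˢ?_)
open import Data.Bool.Base using (true; false)
open import Data.Bool.Properties using (T-≡)
open import Data.List.Base using (List; []; _∷_; length)
import Data.List.Membership.DecPropositional as DecMembership
open import Data.List.Membership.Propositional
  using () renaming (_∈_ to _∈ˡ_; _∉_ to _∉ˡ_)
open import Data.List.Relation.Binary.Subset.Propositional
  using () renaming (_⊆_ to _⊆ˡ_)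
open import Data.List.Relation.Binary.Subset.Propositional.Properties
  using (∷⁺ʳ)
open import Data.List.Relation.Unary.All.Properties using (¬Any⇒All¬)
open import Data.List.Relation.Unary.AllPairs using ([]; _∷_)
open import Data.List.Relation.Unary.All using ([])
open import Data.List.Relation.Unary.Any as Any using (here; there)
open import Data.List.Relation.Unary.Unique.Propositional using (Unique)
open import Data.List.Relation.Unary.Unique.Propositional.Properties
  using (Unique[x∷xs]⇒x∉xs)
open import Data.Nat.Base using (ℕ; zero; suc; _+_; _≤_; _<_; z≤n; s≤s; s≤s⁻¹)
open import Data.Nat.Properties
  using (≤-refl; ≤-trans; ≤-antisym; <-≤-trans; <-irrefl; m≤n+m; ≮⇒≥;
         +-comm; +-suc; +-identityʳ; suc-injective)
  renaming (_≟_ to _≟ⁿ_)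
open import Data.Product.Base as Product using (_×_; _,_; Σ; ∃; proj₁; proj₂)
open import Data.Sum.Base as Sum using (_⊎_; inj₁; inj₂)
open import Data.Vec.Base as Vec using (_∷_; tabulate)
open import Data.Vec.Properties using (lookup⇒[]=; []=⇒lookup; lookup∘tabulate)
open import Function.Base using (_∘_; id)
open import Function.Bundles using (module Equivalence)
open import Level using (0ℓ)
open import Relation.Binary.Construct.Closure.ReflexiveTransitive
  using (ε; _◅_; _◅◅_; _⋆; reverse) renaming (map to mapStar)
open import Relation.Binary.PropositionalEquality.Core
  using (_≡_; _≢_; refl; sym; trans; cong; subst)
open import Relation.Nullary.Decidable
  using (yes; no; ⌊_⌋; ¬?; _×-dec_; toWitness; fromWitness; decidable-stable)
open import Relation.Nullary.Negation using (¬_; contradiction)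
open import Relation.Unary using (Pred; Decidable; _∈_; _∉_)

-- Finite subsets and their sizes.

module _ {n : ℕ} {P : Pred (Fin n) 0ℓ} (P? : Decidable P) {x : Fin n} where

  ∈-tabulate⁺ : P x → x ∈ˢ tabulate (λ y → ⌊ P? y ⌋)
  ∈-tabulate⁺ Px = lookup⇒[]= x _
    (trans (lookup∘tabulate _ x) (Equivalence.to T-≡ (fromWitness Px)))

  ∈-tabulate⁻ : x ∈ˢ tabulate (λ y → ⌊ P? y ⌋) → P x
  ∈-tabulate⁻ x∈ = toWitness (Equivalence.from T-≡
    (trans (sym (lookup∘tabulate _ x)) ([]=⇒lookup x∈)))

∣p∣≡1+∣p-x∣ : ∀ {n} {p : Subset n} {x} → x ∈ˢ p → ∣ p ∣ ≡ suc ∣ p - x ∣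
∣p∣≡1+∣p-x∣ {p = _ ∷ p} Vec.here = cong (suc ∘ ∣_∣) (sym (p─⊥≡p p))
∣p∣≡1+∣p-x∣ {p = true  ∷ p} (Vec.there x∈p) = cong suc (∣p∣≡1+∣p-x∣ x∈p)
∣p∣≡1+∣p-x∣ {p = false ∷ p} (Vec.there x∈p) = ∣p∣≡1+∣p-x∣ x∈p

module _ {n : ℕ} where

  open DecMembership (_≟_ {n}) using () renaming (_∈?_ to _∈ˡ?_)

  -- Removing `x` a second time changes nothing, whereas removing a member strictly lowers the size.
  x∉p-x : ∀ (p : Subset n) x → x ∉ˢ p - x
  x∉p-x p x x∈p-x = <-irrefl (cong ∣_∣ (p─q─q≡p─q p ⁅ x ⁆)) (x∈p⇒∣p-x∣<∣p∣ x∈p-x)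

  x∈p-y⇒x≢y : ∀ {p : Subset n} {x y} → x ∈ˢ p - y → x ≢ y
  x∈p-y⇒x≢y {p} {x} x∈ refl = x∉p-x p x x∈

  x∈p-y⇒x∈p : ∀ {p : Subset n} {x y} → x ∈ˢ p - y → x ∈ˢ p
  x∈p-y⇒x∈p {p} = p─q⊆p p _

  ∣p∣≡1⇒singleton : ∀ {p : Subset n} → ∣ p ∣ ≡ 1 →
    ∃ λ x → x ∈ˢ p × (∀ {y} → y ∈ˢ p → y ≡ x)
  ∣p∣≡1⇒singleton {p} ∣p∣≡1 with nonempty? p
  ... | no  empty =
    contradiction (trans (sym ∣p∣≡1) (trans (cong ∣_∣ (Empty-unique empty)) (∣⊥∣≡0 n))) λ ()
  ... | yes (x , x∈p) = x , x∈p , λ {y} y∈p → decidable-stable (y ≟ x) λ y≢x →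
    contradiction
      (trans (sym (∣p∣≡1+∣p-x∣ (x∈p∧x≢y⇒x∈p-y y∈p y≢x)))
             (suc-injective (trans (sym (∣p∣≡1+∣p-x∣ x∈p)) ∣p∣≡1)))
      λ ()

  Unique⇒length≤∣p∣ : ∀ {xs} (p : Subset n) → Unique xs → (∀ {x} → x ∈ˡ xs → x ∈ˢ p) →
    length xs ≤ ∣ p ∣
  Unique⇒length≤∣p∣ p [] _ = z≤n
  Unique⇒length≤∣p∣ {x ∷ xs} p xs!@(_ ∷ xs!′) xs⊆p =
    ≤-trans (s≤s (Unique⇒length≤∣p∣ (p - x) xs!′ λ y∈xs →
               x∈p∧x≢y⇒x∈p-y (xs⊆p (there y∈xs))
                 λ { refl → Unique[x∷xs]⇒x∉xs xs! y∈xs }))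
            (x∈p⇒∣p-x∣<∣p∣ (xs⊆p (here refl)))

  Unique⇒length≤n : ∀ {xs : List (Fin n)} → Unique xs → length xs ≤ n
  Unique⇒length≤n xs! = ≤-trans (Unique⇒length≤∣p∣ ⊤ xs! λ _ → ∈⊤) (∣p∣≤n ⊤)

  ∉⇒Unique-∷ : ∀ {x : Fin n} {xs} → x ∉ˡ xs → Unique xs → Unique (x ∷ xs)
  ∉⇒Unique-∷ x∉xs xs! = ¬Any⇒All¬ _ x∉xs ∷ xs!

  -- Edges up to the order of their ends.

  ≈ᵉ-sym : ∀ {e f : Fin n × Fin n} → e ≈ᵉ f → f ≈ᵉ e
  ≈ᵉ-sym (inj₁ (refl , refl)) = inj₁ (refl , refl)
  ≈ᵉ-sym (inj₂ (refl , refl)) = inj₂ (refl , refl)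

  ≈ᵉ-swapˡ : ∀ {a b : Fin n} {e} → (a , b) ≈ᵉ e → (b , a) ≈ᵉ e
  ≈ᵉ-swapˡ (inj₁ (p , q)) = inj₂ (q , p)
  ≈ᵉ-swapˡ (inj₂ (p , q)) = inj₁ (q , p)

  ≈ᵉ-swapʳ : ∀ {a b : Fin n} {e} → e ≈ᵉ (a , b) → e ≈ᵉ (b , a)
  ≈ᵉ-swapʳ = ≈ᵉ-sym ∘ ≈ᵉ-swapˡ ∘ ≈ᵉ-sym

  ≈ᵉ-cancel : ∀ {a b c : Fin n} {e} → (a , b) ≈ᵉ e → (a , c) ≈ᵉ e → c ≡ b
  ≈ᵉ-cancel (inj₁ (refl , refl)) (inj₁ (_ , c≡b))   = c≡b
  ≈ᵉ-cancel (inj₁ (refl , refl)) (inj₂ (a≡b , c≡a)) = trans c≡a a≡b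
  ≈ᵉ-cancel (inj₂ (refl , refl)) (inj₁ (a≡b , c≡a)) = trans c≡a a≡b
  ≈ᵉ-cancel (inj₂ (refl , refl)) (inj₂ (_ , c≡b))   = c≡b

  -- Pendant vertices, walks and paths.

  module _ (G : Graph n) where
    open Graph G renaming (sym to ~-sym; irrefl to ~-irrefl)

    Acyclic : Set
    Acyclic = ¬ Cycle G

    -- Degree 1 in the form that arguments about walks use: a sole neighbour.
    Pendant : Pred (Fin n) 0ℓ
    Pendant x = ∃ λ z → x ~ z × (∀ {y} → x ~ y → y ≡ z)

    ∈-neighbours⁺ : ∀ {x y} → x ~ y → y ∈ˢ neighbours G x
    ∈-neighbours⁺ = ∈-tabulate⁺ (_ ~?_)

    ∈-neighbours⁻ : ∀ {x y} → y ∈ˢ neighbours G x → x ~ y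
    ∈-neighbours⁻ = ∈-tabulate⁻ (_ ~?_)

    ∈-pendants⁺ : ∀ {x} → degree G x ≡ 1 → x ∈ˢ pendants G
    ∈-pendants⁺ = ∈-tabulate⁺ (λ x → degree G x ≟ⁿ 1)

    ∈-pendants⁻ : ∀ {x} → x ∈ˢ pendants G → degree G x ≡ 1
    ∈-pendants⁻ = ∈-tabulate⁻ (λ x → degree G x ≟ⁿ 1)

    Pendant⇒∈pendants : ∀ {x} → Pendant x → x ∈ˢ pendants G
    Pendant⇒∈pendants {x} (z , x~z , z!) = ∈-pendants⁺
      (trans (cong ∣_∣ (⊆-antisym
        (λ y∈ → subst (_∈ˢ ⁅ z ⁆) (sym (z! (∈-neighbours⁻ y∈))) (x∈⁅x⁆ z))
        (λ y∈ → subst (_∈ˢ neighbours G x) (sym (x∈⁅y⁆⇒x≡y z y∈)) (∈-neighbours⁺ x~z))))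
       (∣⁅x⁆∣≡1 z))

    ∈pendants⇒Pendant : ∀ {x} → x ∈ˢ pendants G → Pendant x
    ∈pendants⇒Pendant x∈ with z , z∈ , z! ← ∣p∣≡1⇒singleton (∈-pendants⁻ x∈) =
      z , ∈-neighbours⁻ z∈ , λ x~y → z! (∈-neighbours⁺ x~y)

    walk⇒0<degree : ∀ {x y} → x ≢ y → Walk G x y → 0 < degree G x
    walk⇒0<degree x≢y ε       = contradiction refl x≢y
    walk⇒0<degree x≢y (p ◅ _) =
      subst (0 <_) (sym (∣p∣≡1+∣p-x∣ (∈-neighbours⁺ p))) (s≤s z≤n)

    first∈ : ∀ {x y} (w : Walk G x y) → x ∈ˡ walkVertices G w
    first∈ ε       = here refl
    first∈ (_ ◅ _) = here refl

    last∈ : ∀ {x y} (w : Walk G x y) → y ∈ˡ walkVertices G w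
    last∈ ε       = here refl
    last∈ (_ ◅ w) = there (last∈ w)

    edge⇒vertices : ∀ {x y a b} (w : Walk G x y) → (a , b) ∈ᵉ walkEdges G w →
      a ∈ˡ walkVertices G w × b ∈ˡ walkVertices G w
    edge⇒vertices (_ ◅ w) (here (inj₁ (refl , refl))) = here refl , there (first∈ w)
    edge⇒vertices (_ ◅ w) (here (inj₂ (refl , refl))) = there (first∈ w) , here refl
    edge⇒vertices (_ ◅ w) (there ab∈w) = Product.map there there (edge⇒vertices w ab∈w)

    edge⇒adjacent : ∀ {x y a b} (w : Walk G x y) → (a , b) ∈ᵉ walkEdges G w → a ~ b
    edge⇒adjacent (p ◅ _) (here (inj₁ (refl , refl))) = p
    edge⇒adjacent (p ◅ _) (here (inj₂ (refl , refl))) = ~-sym p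
    edge⇒adjacent (_ ◅ w) (there ab∈w) = edge⇒adjacent w ab∈w

    suffix : ∀ {x y z} (w : Walk G z y) → Unique (walkVertices G w) →
      x ∈ˡ walkVertices G w → Path G x y
    suffix ε       w!       (here refl) = record { walk = ε     ; simple = w! }
    suffix (p ◅ w) w!       (here refl) = record { walk = p ◅ w ; simple = w! }
    suffix (_ ◅ w) (_ ∷ w!) (there x∈w) = suffix w w! x∈w

    prefix : ∀ {x y z} (w : Walk G z y) → x ∈ˡ walkVertices G w →
      Σ (Walk G z x) λ w₁ → walkVertices G w₁ ⊆ˡ walkVertices G w
    prefix ε       (here refl) = ε , id
    prefix (_ ◅ _) (here refl) = ε , λ { (here refl) → here refl }
    prefix (p ◅ w) (there x∈w) with w₁ , w₁⊆w ← prefix w x∈w = p ◅ w₁ , ∷⁺ʳ _ w₁⊆w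

    -- Loop erasure from the far end: if `x` recurs on the path built so far, everything before that
    -- recurrence is dropped.
    toPath : ∀ {x y} → Walk G x y → Path G x y
    toPath ε = record { walk = ε ; simple = [] ∷ [] }
    toPath {x} (p ◅ w) with toPath w
    ... | record { walk = w′ ; simple = w′! } with x ∈ˡ? walkVertices G w′
    ...   | yes x∈w′ = suffix w′ w′! x∈w′
    ...   | no  x∉w′ = record { walk = p ◅ w′ ; simple = ∉⇒Unique-∷ x∉w′ w′! }

    avoid : ∀ {x y e} (w : Walk G x y) → ¬ (e ∈ᵉ walkEdges G w) → Walk (removeEdge G e) x y
    avoid ε       e∉ = ε
    avoid (p ◅ w) e∉ = (p , e∉ ∘ here ∘ ≈ᵉ-sym) ◅ avoid w (e∉ ∘ there)

    walkVertices-map : ∀ {x y e} (w : Walk (removeEdge G e) x y) →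
      walkVertices G (mapStar proj₁ w) ≡ walkVertices (removeEdge G e) w
    walkVertices-map ε       = refl
    walkVertices-map (_ ◅ w) = cong (_ ∷_) (walkVertices-map w)

    walkEdges-map : ∀ {x y e} (w : Walk (removeEdge G e) x y) →
      walkEdges G (mapStar proj₁ w) ≡ walkEdges (removeEdge G e) w
    walkEdges-map ε       = refl
    walkEdges-map (_ ◅ w) = cong (_ ∷_) (walkEdges-map w)

    liftPath : ∀ {x y e} → Path (removeEdge G e) x y → Path G x y
    liftPath record { walk = w ; simple = w! } = record
      { walk = mapStar proj₁ w ; simple = subst Unique (sym (walkVertices-map w)) w! }

    -- On a simple walk an edge is traversed only once.
    split : ∀ {x y a b} (w : Walk G x y) → Unique (walkVertices G w) →
      (a , b) ∈ᵉ walkEdges G w → let G′ = removeEdge G (a , b) in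
      (Walk G′ x a × Walk G′ b y) ⊎ (Walk G′ x b × Walk G′ a y)
    split {a = a} {b} (_◅_ {x} {z} p w) w!@(_ ∷ w!′) ab∈ with (a , b) ≈ᵉ? (x , z)
    ... | yes (inj₁ (refl , refl)) =
      inj₁ (ε , avoid w (Unique[x∷xs]⇒x∉xs w! ∘ proj₁ ∘ edge⇒vertices w))
    ... | yes (inj₂ (refl , refl)) =
      inj₂ (ε , avoid w (Unique[x∷xs]⇒x∉xs w! ∘ proj₂ ∘ edge⇒vertices w))
    ... | no  ab≉xz =
      Sum.map (Product.map₁ (p′ ◅_)) (Product.map₁ (p′ ◅_))
        (split w w!′ (Any.tail ab≉xz ab∈))
      where p′ = p , ab≉xz ∘ ≈ᵉ-sym

  -- Acyclic graphs: the pendant vertices form an MEG-set.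

  module _ (G : Graph n) (acyclic : Acyclic G) where
    open Graph G renaming (sym to ~-sym; irrefl to ~-irrefl)

    -- Such a walk would shorten to a path, which the edge from `b` to `a` closes to a cycle.
    bridge : ∀ {a b} → a ~ b → ¬ Walk (removeEdge G (a , b)) a b
    bridge {a} {b} a~b w = acyclic record
      { path    = liftPath G p
      ; closing = ~-sym a~b
      ; long    = long (Path.walk p)
      }
      where
      G′ = removeEdge G (a , b)

      p : Path G′ a b
      p = toPath G′ w

      -- The path is not empty since `a` and `b` differ, and its only edge cannot be the removed
      -- `ab`.
      long : (w : Walk G′ a b) → 2 ≤ length (walkEdges G (mapStar proj₁ w))
      long ε               = contradiction a~b (~-irrefl refl)
      long ((_ , ab≉) ◅ ε) = contradiction (inj₁ (refl , refl)) ab≉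
      long (_ ◅ _ ◅ _)     = s≤s (s≤s z≤n)

    -- k bounds the number of vertices that are not yet on the path.
    extendToPendant : ∀ k {x z b e} (p : x ~ z) (w : Walk G z b) →
      Unique (walkVertices G (p ◅ w)) → n < length (walkVertices G (p ◅ w)) + k →
      e ∈ᵉ walkEdges G (p ◅ w) →
      ∃ λ y → Pendant G y × Σ (Path G y b) λ q → e ∈ᵉ Path.edges q
    extendToPendant k {x} {z} p w w! n< e∈
      with any? (λ y → (x ~? y) ×-dec ¬? (y ≟ z))
    ... | no ∄y =
      x , (z , p , λ {y} x~y → decidable-stable (y ≟ z) λ y≢z → ∄y (y , x~y , y≢z)) ,
      record { walk = p ◅ w ; simple = w! } , e∈
    ... | yes (y , x~y , y≢z) with y ∈ˡ? walkVertices G (p ◅ w)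
    ...   | yes (here refl) = contradiction x~y (~-irrefl refl)
    -- A neighbour `y` further along the path is reached from `x` through `z` without the edge `xy`:
    -- the rest of the path never returns to `x`. This contradicts `bridge`.
    ...   | yes (there y∈w) with w₁ , w₁⊆w ← prefix G w y∈w =
      contradiction
        ((p , y≢z ∘ sym ∘ ≈ᵉ-cancel (inj₁ (refl , refl))) ◅
         avoid G w₁ (Unique[x∷xs]⇒x∉xs w! ∘ w₁⊆w ∘ proj₁ ∘ edge⇒vertices G w₁))
        (bridge x~y)
    -- With no vertex left over, the path would have more than `n` distinct vertices.
    extendToPendant zero {x} {z} p w w! n< e∈
          | yes (y , x~y , y≢z) | no y∉ =
      contradiction (<-≤-trans (subst (n <_) (+-identityʳ _) n<) (Unique⇒length≤n w!))
        (<-irrefl refl)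
    extendToPendant (suc k) {x} {z} p w w! n< e∈
          | yes (y , x~y , y≢z) | no y∉ =
      extendToPendant k (~-sym x~y) (p ◅ w) (∉⇒Unique-∷ y∉ w!)
        (subst (n <_) (+-suc _ k) n<) (there e∈)

    -- The path consisting of `ab` alone is extended at `a` until it starts at a pendant vertex `x`.
    -- Cutting the result at `ab` leaves a walk from `x` to `a`; the other orientation would join
    -- `a` to `b` without `ab`.
    pendantBeyond : ∀ {a b} → a ~ b →
      ∃ λ x → Pendant G x × Walk (removeEdge G (a , b)) x a
    pendantBeyond {a} {b} a~b
      with extendToPendant n a~b ε
             (∉⇒Unique-∷ (λ { (here refl) → ~-irrefl refl a~b }) ([] ∷ []))
             -- The initial path already has two vertices, so `n` is enough as the bound:
             -- `n < 2 + n`.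
             (s≤s (m≤n+m n 1)) (here (inj₁ (refl , refl)))
    ... | x , pendant , record { walk = w ; simple = w! } , ab∈ with split G w w! ab∈
    ...   | inj₁ (x⇝a , _) = x , pendant , x⇝a
    ...   | inj₂ (_ , a⇝b) = contradiction a⇝b (bridge a~b)

    -- The monitoring pair consists of a pendant vertex beyond each end of `ab`. Every path between
    -- them, shortest or not, uses `ab`: otherwise going from `a` to `x`, along the path to `y` and
    -- on to `b` would bypass a bridge.
    pendants-MEGSet : MEGSet G (pendants G)
    pendants-MEGSet {a} {b} a~b
      with x , x-pendant , x⇝a ← pendantBeyond a~b
         | y , y-pendant , y⇝b ← pendantBeyond (~-sym a~b) =
      x , y , Pendant⇒∈pendants G x-pendant , Pendant⇒∈pendants G y-pendant , monitors
      where
      G′ = removeEdge G (a , b)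

      monitors : Monitors G x y (a , b)
      monitors p _ = decidable-stable (Any.any? ((a , b) ≈ᵉ?_) (Path.edges p)) λ ab∉p →
        bridge a~b
          (reverse (Graph.sym G′) x⇝a ◅◅ avoid G (Path.walk p) ab∉p ◅◅
           mapStar (Product.map₂ (_∘ ≈ᵉ-swapʳ)) y⇝b)

  -- Every MEG-set contains the pendant vertices.

  module _ (G : Graph n) where
    open Graph G renaming (sym to ~-sym; irrefl to ~-irrefl)

    -- If no path were shortest, sizes could decrease forever. The double negation does no harm,
    -- because the goal it serves, membership in a subset, is decidable.
    ¬¬-shortest : ∀ {x y} → Path G x y → ¬ ¬ ∃ (Shortest G {x} {y})
    ¬¬-shortest {x} {y} p ∄shortest = no-path _ p ≤-refl
      where
      no-path : ∀ k (q : Path G x y) → ¬ (Path.size q < k)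
      no-path (suc k) q q<1+k = ∄shortest
        (q , λ r → ≮⇒≥ λ r<q → no-path k r (≤-trans r<q (s≤s⁻¹ q<1+k)))

    -- At an inner vertex the predecessor and the successor would both be the sole neighbour, so the
    -- walk would repeat a vertex.
    Pendant⇒endpoint : ∀ {x s t} → Pendant G x → (w : Walk G s t) →
      Unique (walkVertices G w) → x ∈ˡ walkVertices G w → x ≡ s ⊎ x ≡ t
    Pendant⇒endpoint _       ε                _  (here x≡s) = inj₁ x≡s
    Pendant⇒endpoint _       (_ ◅ _)          _  (here x≡s) = inj₁ x≡s
    Pendant⇒endpoint _       (_ ◅ ε)          _  (there (here x≡t)) = inj₂ x≡t
    Pendant⇒endpoint (_ , _ , z!) (p ◅ q ◅ w) w! (there (here refl)) =
      contradiction
        (subst (_∈ˡ _) (trans (z! q) (sym (z! (~-sym p)))) (there (first∈ G w)))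
        (Unique[x∷xs]⇒x∉xs w!)
    Pendant⇒endpoint pendant (_ ◅ w@(_ ◅ _)) (_ ∷ w!) (there (there x∈w))
      with Pendant⇒endpoint pendant w w! (there x∈w)
    ... | inj₁ refl = contradiction x∈w (Unique[x∷xs]⇒x∉xs w!)
    ... | inj₂ x≡t  = inj₂ x≡t

    -- The edge at `x` is monitored by some pair in `M`, hence `x` lies on a shortest path between
    -- the two and must be one of its ends.
    pendants⊆MEGSet : Connected G → ∀ {M} → MEGSet G M → pendants G ⊆ˢ M
    pendants⊆MEGSet connected {M} meg {x} x∈
      with pendant@(z , x~z , _) ← ∈pendants⇒Pendant G x∈
      with s , t , s∈M , t∈M , monitors ← meg x~z =
      decidable-stable (x ∈ˢ? M) λ x∉M →
        ¬¬-shortest (connected s t) λ (p , shortest) →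
          Sum.[ (λ { refl → x∉M s∈M }) , (λ { refl → x∉M t∈M }) ]′
            (Pendant⇒endpoint pendant (Path.walk p) (Path.simple p)
              (proj₁ (edge⇒vertices G (Path.walk p) (monitors p shortest))))

    tree-IsMeg : Connected G → Acyclic G → IsMeg G ∣ pendants G ∣
    tree-IsMeg connected acyclic = record
      { connected = connected
      ; attained  = pendants G , pendants-MEGSet G acyclic , refl
      ; minimal   = λ M meg → p⊆q⇒∣p∣≤∣q∣ (pendants⊆MEGSet connected meg)
      }

    -- Removing a cycle edge leaves a connected acyclic graph.

    -- The first edge leads to an inner vertex rather than to `y`, and no later edge touches `x`.
    closing∉ : ∀ {x y} (w : Walk G x y) → Unique (walkVertices G w) →
      2 ≤ length (walkEdges G w) → ¬ ((x , y) ∈ᵉ walkEdges G w)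
    closing∉ (_ ◅ ε)     _        (s≤s ())
    closing∉ (_ ◅ _ ◅ w) (_ ∷ w!) _ (here (inj₁ (_ , refl))) =
      Unique[x∷xs]⇒x∉xs w! (last∈ G w)
    closing∉ (_ ◅ w)     w!       _ (here (inj₂ (_ , refl))) =
      Unique[x∷xs]⇒x∉xs w! (last∈ G w)
    closing∉ (_ ◅ w)     w!       _ (there xy∈w) =
      Unique[x∷xs]⇒x∉xs w! (proj₁ (edge⇒vertices G w xy∈w))

    module _ (C : Cycle G) where
      open Cycle C using (first; last; path; closing; long)
      open Path path using (walk; simple)

      cycleEdge⇒adjacent : ∀ {u v} → (u , v) ∈ᵉ Cycle.edges C → u ~ v
      cycleEdge⇒adjacent (here (inj₁ (refl , refl))) = closing
      cycleEdge⇒adjacent (here (inj₂ (refl , refl))) = ~-sym closing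
      cycleEdge⇒adjacent (there uv∈) = edge⇒adjacent G walk uv∈

      cycleEdge⇒vertices : ∀ {u v} → (u , v) ∈ᵉ Cycle.edges C →
        u ∈ˡ Cycle.vertices C × v ∈ˡ Cycle.vertices C
      cycleEdge⇒vertices (here (inj₁ (refl , refl))) = last∈ G walk , first∈ G walk
      cycleEdge⇒vertices (here (inj₂ (refl , refl))) = first∈ G walk , last∈ G walk
      cycleEdge⇒vertices (there uv∈) = edge⇒vertices G walk uv∈

      -- This goes round the cycle the other way. If `uv` is the closing edge, the path itself
      -- serves; otherwise `uv` cuts the path into two pieces, which the closing edge joins.
      detour : ∀ {u v} → (u , v) ∈ᵉ Cycle.edges C → Walk (removeEdge G (u , v)) u v
      detour {u} {v} uv∈ with (u , v) ≈ᵉ? (last , first)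
      ... | yes (inj₁ (refl , refl)) =
        reverse (Graph.sym (removeEdge G _))
          (avoid G walk (closing∉ walk simple long ∘ Any.map ≈ᵉ-swapˡ))
      ... | yes (inj₂ (refl , refl)) = avoid G walk (closing∉ walk simple long)
      ... | no uv≉ with split G walk simple (Any.tail uv≉ uv∈)
      ...   | inj₁ (first⇝u , v⇝last) =
        back first⇝u ◅◅ (~-sym closing , uv≉ ∘ ≈ᵉ-sym ∘ ≈ᵉ-swapˡ) ◅ back v⇝last
        where
        back : ∀ {x y} → Walk (removeEdge G (u , v)) x y → Walk (removeEdge G (u , v)) y x
        back = reverse (Graph.sym (removeEdge G (u , v)))
      ...   | inj₂ (first⇝v , u⇝last) =
        u⇝last ◅◅ (closing , uv≉ ∘ ≈ᵉ-sym) ◅ first⇝v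

    -- Each step along `uv` is replaced by the given walk, in the appropriate direction.
    removeEdge-connected : Connected G → ∀ {u v} → Walk (removeEdge G (u , v)) u v →
      Connected (removeEdge G (u , v))
    removeEdge-connected connected {u} {v} u⇝v x y =
      toPath G′ ((bypass ⋆) (Path.walk (connected x y)))
      where
      G′ = removeEdge G (u , v)

      bypass : ∀ {a b} → a ~ b → Walk G′ a b
      bypass {a} {b} a~b with (a , b) ≈ᵉ? (u , v)
      ... | yes (inj₁ (refl , refl)) = u⇝v
      ... | yes (inj₂ (refl , refl)) = reverse (Graph.sym G′) u⇝v
      ... | no  ab≉uv                = (a~b , ab≉uv) ◅ ε

  module _ (G : Graph n) where

    -- A cycle of `G′` is also a cycle of `G`, so by uniqueness it contains `uv`, which is not an
    -- edge of `G′`.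
    removeEdge-acyclic : (unicyclic : Unicyclic G) → ∀ {u v} →
      (u , v) ∈ᵉ Cycle.edges (Unicyclic.cycle unicyclic) → Acyclic (removeEdge G (u , v))
    removeEdge-acyclic unicyclic {u} {v} uv∈C⋆ C = absurd uv∈D
      where
      G′ = removeEdge G (u , v)
      open Cycle C using (path; closing; long)

      D : Cycle G
      D = record
        { path    = liftPath G path
        ; closing = proj₁ closing
        ; long    = subst (λ es → 2 ≤ length es) (sym (walkEdges-map G (Path.walk path))) long
        }

      uv∈D : (u , v) ∈ᵉ Cycle.edges D
      uv∈D = Equivalence.from (Unicyclic.unique unicyclic D (u , v)) uv∈C⋆

      absurd : ¬ ((u , v) ∈ᵉ Cycle.edges D)
      absurd uv∈ = proj₂ (cycleEdge⇒adjacent G′ C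
        (subst (λ es → (u , v) ∈ᵉ _ ∷ es) (walkEdges-map G (Path.walk path)) uv∈))
        (inj₁ (refl , refl))

  -- Comparing the sizes of two sets that differ in at most two points.

  -- This amounts to `p` being `q` with `x` and `y` taken out, so the sizes differ by the number of
  -- these points in `q`. It is applied to the pendant vertices before and after the removal of the
  -- edge `xy`.
  record AgreeOff (x y : Fin n) (p q : Subset n) : Set where
    field
      x∉p : x ∉ˢ p
      y∉p : y ∉ˢ p
      p⊆q : p ⊆ˢ q
      q⊆p : ∀ {z} → z ≢ x → z ≢ y → z ∈ˢ q → z ∈ˢ p

    ∈p⇒≢x : ∀ {z} → z ∈ˢ p → z ≢ x
    ∈p⇒≢x z∈p refl = x∉p z∈p

    ∈p⇒≢y : ∀ {z} → z ∈ˢ p → z ≢ y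
    ∈p⇒≢y z∈p refl = y∉p z∈p

    ∣q∣≡∣p∣ : x ∉ˢ q → y ∉ˢ q → ∣ q ∣ ≡ ∣ p ∣
    ∣q∣≡∣p∣ x∉q y∉q = cong ∣_∣ (⊆-antisym
      (λ z∈q → q⊆p (λ { refl → x∉q z∈q }) (λ { refl → y∉q z∈q }) z∈q) p⊆q)

    ∣q∣≡1+∣p∣ : x ∈ˢ q → y ∉ˢ q → ∣ q ∣ ≡ suc ∣ p ∣
    ∣q∣≡1+∣p∣ x∈q y∉q = trans (∣p∣≡1+∣p-x∣ x∈q) (cong (suc ∘ ∣_∣) (⊆-antisym
      (λ z∈ → q⊆p (x∈p-y⇒x≢y z∈) (λ { refl → y∉q (x∈p-y⇒x∈p z∈) }) (x∈p-y⇒x∈p z∈))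
      (λ z∈p → x∈p∧x≢y⇒x∈p-y (p⊆q z∈p) (∈p⇒≢x z∈p))))

    ∣q∣≡2+∣p∣ : x ≢ y → x ∈ˢ q → y ∈ˢ q → ∣ q ∣ ≡ suc (suc ∣ p ∣)
    ∣q∣≡2+∣p∣ x≢y x∈q y∈q = trans (∣p∣≡1+∣p-x∣ x∈q) (cong suc
      (trans (∣p∣≡1+∣p-x∣ (x∈p∧x≢y⇒x∈p-y y∈q (x≢y ∘ sym)))
        (cong (suc ∘ ∣_∣) (⊆-antisym
          (λ z∈ → q⊆p (x∈p-y⇒x≢y (x∈p-y⇒x∈p z∈)) (x∈p-y⇒x≢y z∈)
                      (x∈p-y⇒x∈p (x∈p-y⇒x∈p z∈)))
          (λ z∈p → x∈p∧x≢y⇒x∈p-y (x∈p∧x≢y⇒x∈p-y (p⊆q z∈p) (∈p⇒≢x z∈p)) (∈p⇒≢y z∈p))))))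

  -- This lets `∣q∣≡1+∣p∣` cover both ways in which exactly one of the two points lies in `q`.
  AgreeOff-sym : ∀ {x y p q} → AgreeOff x y p q → AgreeOff y x p q
  AgreeOff-sym agree = record
    { x∉p = y∉p ; y∉p = x∉p ; p⊆q = p⊆q ; q⊆p = λ z≢y z≢x → q⊆p z≢x z≢y }
    where open AgreeOff agree

  -- Degrees and pendant vertices after the removal of an edge.

  module _ (G : Graph n) where
    open Graph G renaming (sym to ~-sym; irrefl to ~-irrefl)

    -- The neighbourhood of `u` loses exactly `v`. Taking `e` only up to order makes the lemma apply
    -- to both ends of the removed edge.
    degree-removeEdge : ∀ {u v e} → u ~ v → (u , v) ≈ᵉ e →
      degree G u ≡ suc (degree (removeEdge G e) u)
    degree-removeEdge {u} {v} {e} u~v uv≈e =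
      trans (∣p∣≡1+∣p-x∣ (∈-neighbours⁺ G u~v)) (cong (suc ∘ ∣_∣) (⊆-antisym N-v⊆N′ N′⊆N-v))
      where
      G′ = removeEdge G e
      N  = neighbours G u
      N′ = neighbours G′ u

      N-v⊆N′ : N - v ⊆ˢ N′
      N-v⊆N′ y∈ = ∈-neighbours⁺ G′
        ( ∈-neighbours⁻ G (x∈p-y⇒x∈p {p = N} y∈)
        , x∈p-y⇒x≢y {p = N} y∈ ∘ ≈ᵉ-cancel uv≈e)

      N′⊆N-v : N′ ⊆ˢ N - v
      N′⊆N-v y∈ with u~y , uy≉e ← ∈-neighbours⁻ G′ y∈ =
        x∈p∧x≢y⇒x∈p-y (∈-neighbours⁺ G u~y) λ { refl → uy≉e uv≈e }


    module _ {u v e} (u~v : u ~ v) (uv≈e : (u , v) ≈ᵉ e)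
             (connected : Connected (removeEdge G e)) where
      private G′ = removeEdge G e

      -- Since `u` still reaches `v` in `G′`, it has an edge besides the removed one.
      1<degree : 1 < degree G u
      1<degree = subst (1 <_) (sym (degree-removeEdge u~v uv≈e)) (s≤s
        (walk⇒0<degree G′ (λ u≡v → ~-irrefl u≡v u~v) (Path.walk (connected u v))))

      endpoint∉pendants : u ∉ˢ pendants G
      endpoint∉pendants u∈ = <-irrefl (sym (∈-pendants⁻ G u∈)) 1<degree

      endpoint∉pendants′ : 3 ≤ degree G u → u ∉ˢ pendants G′
      endpoint∉pendants′ 3≤deg u∈ = <-irrefl
        (sym (trans (degree-removeEdge u~v uv≈e) (cong suc (∈-pendants⁻ G′ u∈)))) 3≤deg

      endpoint∈pendants′ : ¬ 3 ≤ degree G u → u ∈ˢ pendants G′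
      endpoint∈pendants′ 3≰deg = ∈-pendants⁺ G′ (suc-injective
        (trans (sym (degree-removeEdge u~v uv≈e))
               (≤-antisym (≮⇒≥ 3≰deg) 1<degree)))

    -- Vertices other than `u` and `v` keep all their neighbours, while `u` and `v` have degree at
    -- least 2 in `G`.
    pendants-removeEdge : ∀ {u v} → u ~ v → Connected (removeEdge G (u , v)) →
      AgreeOff u v (pendants G) (pendants (removeEdge G (u , v)))
    pendants-removeEdge {u} {v} u~v connected = record
      { x∉p = u∉
      ; y∉p = v∉
      ; p⊆q = λ {w} w∈ →
          let z , w~z , z! = ∈pendants⇒Pendant G w∈ in
          Pendant⇒∈pendants G′
            (z , keep (λ { refl → u∉ w∈ }) (λ { refl → v∉ w∈ }) w~z , z! ∘ proj₁)
      ; q⊆p = λ w≢u w≢v w∈ →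
          let z , (w~z , _) , z! = ∈pendants⇒Pendant G′ w∈ in
          Pendant⇒∈pendants G (z , w~z , z! ∘ keep w≢u w≢v)
      }
      where
      G′ = removeEdge G (u , v)

      u∉ : u ∉ˢ pendants G
      u∉ = endpoint∉pendants u~v (inj₁ (refl , refl)) connected

      v∉ : v ∉ˢ pendants G
      v∉ = endpoint∉pendants (~-sym u~v) (inj₂ (refl , refl)) connected

      keep : ∀ {w z} → w ≢ u → w ≢ v → w ~ z → Graph._~_ G′ w z
      keep w≢u w≢v w~z = w~z , Sum.[ w≢u ∘ proj₁ , w≢v ∘ proj₁ ]′

corollary3p6 :
    ∀ {n : ℕ} (G : Graph n) (unicyclic : Unicyclic G) (k l : ℕ) →
    let C⋆  = Unicyclic.cycle unicyclic
        V⁺⋆ = V⁺ G C⋆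
    in
    Cycle.size C⋆ ≡ k →
    ∣ pendants G ∣ ≡ l →
    ∀ (u v : Fin n) → (u , v) ∈ᵉ Cycle.edges C⋆ →
    let G′ = removeEdge G (u , v)
    in
      (u ∈ V⁺⋆ × v ∈ V⁺⋆ → IsMeg G′ l)
    × ((u ∈ V⁺⋆ × v ∉ V⁺⋆) ⊎ (u ∉ V⁺⋆ × v ∈ V⁺⋆) → IsMeg G′ (l + 1))
    × (u ∉ V⁺⋆ × v ∉ V⁺⋆ → IsMeg G′ (l + 2))
corollary3p6 G unicyclic k l _ refl u v uv∈ =
    (λ (u⁺ , v⁺) → isMeg (Agree.∣q∣≡∣p∣ (u∉ u⁺) (v∉ v⁺)))
  , Sum.[ (λ (u⁺ , v⁻) → isMeg (trans (Agreeˢ.∣q∣≡1+∣p∣ (v∈ v⁻) (u∉ u⁺)) (+-comm 1 l)))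
        , (λ (u⁻ , v⁺) → isMeg (trans (Agree.∣q∣≡1+∣p∣ (u∈ u⁻) (v∉ v⁺)) (+-comm 1 l))) ]′
  , (λ (u⁻ , v⁻) → isMeg (trans (Agree.∣q∣≡2+∣p∣ u≢v (u∈ u⁻) (v∈ v⁻)) (+-comm 2 l)))
  where
  open Unicyclic unicyclic
  G′ = removeEdge G (u , v)

  connected′ : Connected G′
  connected′ = removeEdge-connected G connected (detour G cycle uv∈)

  u~v = cycleEdge⇒adjacent G cycle uv∈
  v~u = Graph.sym G u~v

  u≢v : u ≢ v
  u≢v u≡v = Graph.irrefl G u≡v u~v

  on-cycle = cycleEdge⇒vertices G cycle uv∈

  agree = pendants-removeEdge G u~v connected′
  module Agree  = AgreeOff agree
  module Agreeˢ = AgreeOff (AgreeOff-sym agree)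

  isMeg : ∀ {m} → ∣ pendants G′ ∣ ≡ m → IsMeg G′ m
  isMeg eq = subst (IsMeg G′) eq
    (tree-IsMeg G′ connected′ (removeEdge-acyclic G unicyclic uv∈))

  u∉ : u ∈ V⁺ G cycle → u ∉ˢ pendants G′
  u∉ (_ , 3≤deg) = endpoint∉pendants′ G u~v (inj₁ (refl , refl)) connected′ 3≤deg

  v∉ : v ∈ V⁺ G cycle → v ∉ˢ pendants G′
  v∉ (_ , 3≤deg) = endpoint∉pendants′ G v~u (inj₂ (refl , refl)) connected′ 3≤deg

  -- As `u` lies on the cycle, it can only fail to be in `V⁺` by having degree below 3.
  u∈ : u ∉ V⁺ G cycle → u ∈ˢ pendants G′
  u∈ u∉V⁺ = endpoint∈pendants′ G u~v (inj₁ (refl , refl)) connected′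
    (u∉V⁺ ∘ (proj₁ on-cycle ,_))

  v∈ : v ∉ V⁺ G cycle → v ∈ˢ pendants G′
  v∈ v∉V⁺ = endpoint∈pendants′ G v~u (inj₂ (refl , refl)) connected′
    (v∉V⁺ ∘ (proj₂ on-cycle ,_))
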